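{- Let $(\mathcal S,\mathcal T)$ be a token system. Then $(\mathcal S,\mathcal T)$ is a medium if and only if the following four conditions hold: [M1] Any token has a reverse. [M2] For any two distinct states $S,V$ in $\mathcal S$ there is a consistent message transforming $S$ into $V$. [M3] A message which is stepwise effective for some state is ineffective for that state if and only if it is vacuous. [M4] Two stepwise effective, consistent messages producing the same state (that is, $\boldsymbol m$ stepwise effective for $S$ and $\boldsymbol n$ stepwise effective for $W$ with $S\boldsymbol m=W\boldsymbol n$, for some states $S,W$) are jointly consistent.
   Context: No set is assumed to be finite. Token systems. Let $\mathcal S$ be a set of states with $|\mathcal S|\ge 2$. A token is a function $\tau:\mathcal S\to\mathcal S$, written $S\mapsto S\tau$, different from the identity function $\tau_0$ on $\mathcal S$; compositions are written $S\tau_1\tau_2\cdots\tau_n=\tau_n[\cdots\tau_2[\tau_1(S)]\cdots]$. A token system is a pair $(\mathcal S,\mathcal T)$ with $\mathcal T\ne\emptyset$ a set of tokens on $\mathcal S$. For distinct states $S,V$, $V$ is adjacent to $S$ if $S\tau=V$ for some $\tau\in\mathcal T$. A token $\tilde\tau\in\mathcal T$ is a reverse of a token $\tau$ if for any two adjacent states $S,V$ (distinct states, one of which is adjacent to the other) we have $S\tau=V\iff V\tilde\tau=S$. A token has at most one reverse. Messages. A message is a string $\boldsymbol m=\tau_1\ldots\tau_n$ of tokens of $\mathcal T$; it defines the function $S\mapsto S\boldsymbol m=S\tau_1\cdots\tau_n$, and produces $V$ from $S$ (transforms $S$ into $V$) if $S\boldsymbol m=V$. It is ineffective for $S$ if $S\boldsymbol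 m=S$; stepwise effective for $S$ if $S\tau_1\cdots\tau_k\ne S\tau_0\cdots\tau_{k-1}$ for $1\le k\le n$; a return (for $S$) if it is both stepwise effective and ineffective for $S$; consistent if it does not contain both a token and its reverse; concise for $S$ if it is consistent, stepwise effective for $S$, and no token occurs in it more than once; vacuous if $\{1,\ldots,n\}$ can be partitioned into pairs $\{i,j\}$ such that $\tau_i,\tau_j$ are mutual reverses. Two messages $\boldsymbol m,\boldsymbol n$ are jointly consistent if the concatenation $\boldsymbol m\boldsymbol n$ is consistent. A token system $(\mathcal S,\mathcal T)$ is a medium if: [Ma] for any two distinct states $S,V$ there is a concise message producing $V$ from $S$; [Mb] any return message is vacuous. -}

module Defs where

open import Data.Fin.Base using (Fin)
open import Data.List.Base using (List; []; _∷_; _++_; length; take; lookup; foldl; concatMap; allFin)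
open import Data.List.Relation.Binary.Permutation.Propositional using (_↭_)
open import Data.List.Relation.Unary.All using (All)
import Data.List.Membership.Setoid as Membership
import Data.List.Relation.Unary.Unique.Setoid as Uniqueness
open import Data.Nat.Base as ℕ using (ℕ; _<_)
open import Data.Product.Base using (∃; ∃-syntax; Σ-syntax; ∃₂; _×_; _,_; proj₁)
open import Data.Sum.Base using (_⊎_)
open import Function.Base using (id)
open import Function.Bundles using (_⇔_)
open import Level using (Level; suc; _⊔_)
open import Relation.Binary.Bundles using (Setoid)
import Relation.Binary.Construct.On as On
open import Relation.Binary.PropositionalEquality using (_≡_; _≢_; _≗_; _→-setoid_)
open import Relation.Nullary.Negation using (¬_)
open import Relation.Unary using (Pred; Satisfiable)

-- Equality of functions is read extensionally (_≗_) throughout, so that no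
-- function extensionality axiom is needed.

record TokenSystem (s t : Level) : Set (suc (s ⊔ t)) where
  field
    State      : Set s
    𝒯          : Pred (State → State) t
    𝒯-nonId    : ∀ {τ} → 𝒯 τ → ¬ (τ ≗ id)
    𝒯-nonEmpty : Satisfiable 𝒯
    twoStates  : ∃₂ λ (S V : State) → S ≢ V

-- A partition of the positions into pairs is a list of pairs in whose
-- entries every position occurs exactly once.
IsPairing : (n : ℕ) → List (Fin n × Fin n) → Set
IsPairing n ps = concatMap entries ps ↭ allFin n
  where
  entries : Fin n × Fin n → List (Fin n)
  entries (i , j) = i ∷ j ∷ []

module _ {s t : Level} (𝒮𝒯 : TokenSystem s t) where
  open TokenSystem 𝒮𝒯

  Token : Set (s ⊔ t)
  Token = ∃ 𝒯

  -- Tokens are compared as functions: membership proofs are ignored.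
  tokenSetoid : Setoid (s ⊔ t) s
  tokenSetoid = On.setoid {B = Token} (State →-setoid State) proj₁

  open Membership tokenSetoid using (_∈_)
  open Uniqueness tokenSetoid using (Unique)

  infixl 8 _·_ _∙_

  _·_ : State → Token → State
  S · (τ , _) = τ S

  AdjacentTo : State → State → Set (s ⊔ t)
  AdjacentTo V S = S ≢ V × (∃[ τ ] S · τ ≡ V)

  Adjacent : State → State → Set (s ⊔ t)
  Adjacent S V = AdjacentTo V S ⊎ AdjacentTo S V

  -- IsReverse τ̃ τ : τ̃ is a reverse of τ.
  IsReverse : Token → Token → Set (s ⊔ t)
  IsReverse τ̃ τ = ∀ S V → Adjacent S V → (S · τ ≡ V ⇔ V · τ̃ ≡ S)

  MutualReverses : Token → Token → Set (s ⊔ t)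
  MutualReverses σ τ = IsReverse σ τ × IsReverse τ σ

  -- The empty message is allowed.
  Message : Set (s ⊔ t)
  Message = List Token

  _∙_ : State → Message → State
  _∙_ = foldl _·_

  Produces : Message → State → State → Set s
  Produces m S V = S ∙ m ≡ V

  Ineffective : State → Message → Set s
  Ineffective S m = S ∙ m ≡ S

  -- The index k runs over 0, …, n - 1 rather than 1, …, n.
  StepwiseEffective : State → Message → Set s
  StepwiseEffective S m =
    ∀ k → k < length m → S ∙ take (ℕ.suc k) m ≢ S ∙ take k m

  Return : State → Message → Set s
  Return S m = StepwiseEffective S m × Ineffective S m

  -- σ and τ are not required to be distinct: a message containing a token
  -- that is its own reverse is inconsistent.
  Consistent : Message → Set (s ⊔ t)
  Consistent m = ∀ σ τ → σ ∈ m → τ ∈ m → ¬ IsReverse σ τ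

  Concise : State → Message → Set (s ⊔ t)
  Concise S m = Consistent m × StepwiseEffective S m × Unique m

  Vacuous : Message → Set (s ⊔ t)
  Vacuous m = Σ[ ps ∈ List (Fin n × Fin n) ] IsPairing n ps × All Reversed ps
    where
    n : ℕ
    n = length m

    Reversed : Fin n × Fin n → Set (s ⊔ t)
    Reversed (i , j) = MutualReverses (lookup m i) (lookup m j)

  JointlyConsistent : Message → Message → Set (s ⊔ t)
  JointlyConsistent m n = Consistent (m ++ n)

  Ma : Set (s ⊔ t)
  Ma = ∀ S V → S ≢ V → ∃[ m ] Concise S m × Produces m S V

  Mb : Set (s ⊔ t)
  Mb = ∀ S m → Return S m → Vacuous m

  IsMedium : Set (s ⊔ t)
  IsMedium = Ma × Mb

  M1 : Set (s ⊔ t)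
  M1 = ∀ τ → ∃[ τ̃ ] IsReverse τ̃ τ

  M2 : Set (s ⊔ t)
  M2 = ∀ S V → S ≢ V → ∃[ m ] Consistent m × Produces m S V

  M3 : Set (s ⊔ t)
  M3 = ∀ S m → StepwiseEffective S m → (Ineffective S m ⇔ Vacuous m)

  M4 : Set (s ⊔ t)
  M4 = ∀ S W m n →
       StepwiseEffective S m → Consistent m →
       StepwiseEffective W n → Consistent n →
       S ∙ m ≡ W ∙ n → JointlyConsistent m n

{-# OPTIONS --safe #-}

-- For mutual reverses σ and τ, a vacuous message contains as many copies of σ
-- as of τ.  In a medium, one obtains from [Mb] that any token τ has a reverse
-- by closing a step S ↦ S τ up to a return, that a vacuous stepwise effective
-- message m is ineffective since a concise message closing m up to a return
-- would contain equally many σ and τ, and [M4] by walking along m, then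
-- backwards along n, then along a concise message p: if σ occurs in m and its
-- reverse τ in n, this return contains σ twice, but τ at most once, in p.
-- Conversely, deleting the ineffective steps of a consistent message makes it
-- concise: if it were to pass τ twice, then its part before the second passage
-- and the reverse of τ at that passage would contradict [M4].

module Submission where

open import Axiom.ExcludedMiddle using (ExcludedMiddle)
open import Data.Bool.Base using (if_then_else_)
open import Data.Fin.Base using (Fin)
open import Data.List.Base
  using (List; []; _∷_; _++_; [_]; map; concatMap; allFin; lookup)
import Data.List.Membership.Propositional as Propositional
open import Data.List.Membership.Propositional.Properties using (∈-∃++)
import Data.List.Membership.Setoid as Membership
open import Data.List.Properties
  using (foldl-++; map-++; map-tabulate; tabulate-lookup)
open import Data.List.Relation.Binary.Permutation.Propositional using (↭-sym)
open import Data.List.Relation.Binary.Permutation.Propositional.Properties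
  using (All-resp-↭; map⁺)
open import Data.List.Relation.Unary.All as All using (All; []; _∷_)
open import Data.List.Relation.Unary.AllPairs using ([]; _∷_)
open import Data.List.Relation.Unary.Any using (here; there)
open import Data.List.Relation.Unary.Any.Properties using (++⁺ˡ; ++⁺ʳ; ++⁻)
import Data.List.Relation.Unary.Unique.Setoid as Uniqueness
open import Data.Nat.Base using (ℕ; zero; suc; _+_; _≤_; z≤n; s≤s; s<s)
open import Data.Nat.ListAction using (sum)
open import Data.Nat.ListAction.Properties using (sum-++; sum-↭)
open import Data.Nat.Properties
  using ( ≤-trans; ≤-reflexive; m≤n+m; m≤m+n; +-assoc; +-comm; +-cancelˡ-≡
        ; +-mono-≤; 1+n≰n; module ≤-Reasoning)
open import Data.Product.Base using (∃-syntax; _×_; _,_; proj₁; proj₂)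
open import Data.Sum.Base using (inj₁; inj₂; swap)
open import Function.Base using (_∘_)
open import Function.Bundles using (_⇔_; mk⇔; Equivalence)
open import Function.Properties.Equivalence using () renaming (sym to ⇔-sym)
open import Level using (Level; _⊔_; Lift; lift; lower)
open import Relation.Binary.Bundles using (Setoid)
open import Relation.Binary.PropositionalEquality
  using (_≡_; _≢_; refl; sym; trans; cong; cong₂; subst; module ≡-Reasoning)
open import Relation.Nullary.Decidable.Core using (Dec; yes; no; does; map′)
open import Relation.Nullary.Decidable using (does-⇔)
open import Relation.Nullary.Negation using (¬_; contradiction)
open import Defs

module _ {s t : Level} (𝒮𝒯 : TokenSystem s t) where
  open TokenSystem 𝒮𝒯
  open Membership (tokenSetoid 𝒮𝒯) using (_∈_; _∉_)
  open Uniqueness (tokenSetoid 𝒮𝒯) using (Unique)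
  open Setoid (tokenSetoid 𝒮𝒯) using (_≈_)

  private
    variable
      S V W : State
      σ τ ρ : Token 𝒮𝒯
      m n   : Message 𝒮𝒯

  -- Stepwise effective messages and concatenation.

  effective-∷⁺ : proj₁ τ S ≢ S → StepwiseEffective 𝒮𝒯 (proj₁ τ S) m →
                 StepwiseEffective 𝒮𝒯 S (τ ∷ m)
  effective-∷⁺ moves eff zero    _         = moves
  -- By computation of `foldl` and `take`, step `suc k` of `τ ∷ m` from `S` is step `k` of `m` from
  -- `proj₁ τ S`.
  effective-∷⁺ moves eff (suc k) (s<s k<n) = eff k k<n

  effective-head : StepwiseEffective 𝒮𝒯 S (τ ∷ m) → proj₁ τ S ≢ S
  effective-head eff = eff 0 (s≤s z≤n)

  effective-tail : StepwiseEffective 𝒮𝒯 S (τ ∷ m) →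
                   StepwiseEffective 𝒮𝒯 (proj₁ τ S) m
  effective-tail eff k k<n = eff (suc k) (s<s k<n)

  effective-++⁺ : ∀ m → StepwiseEffective 𝒮𝒯 S m → Produces 𝒮𝒯 m S V →
                  StepwiseEffective 𝒮𝒯 V n → StepwiseEffective 𝒮𝒯 S (m ++ n)
  effective-++⁺ []      effₘ refl effₙ = effₙ
  effective-++⁺ (τ ∷ m) effₘ prod effₙ = effective-∷⁺ {τ = τ}
    (effective-head {τ = τ} {m = m} effₘ)
    (effective-++⁺ m (effective-tail {τ = τ} {m = m} effₘ) prod effₙ)

  effective-++⁻ˡ : ∀ m → StepwiseEffective 𝒮𝒯 S (m ++ n) → StepwiseEffective 𝒮𝒯 S m
  effective-++⁻ˡ         []      eff = λ _ ()
  effective-++⁻ˡ {n = n} (τ ∷ m) eff = effective-∷⁺ {τ = τ}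
    (effective-head {τ = τ} {m = m ++ n} eff)
    (effective-++⁻ˡ {n = n} m (effective-tail {τ = τ} {m = m ++ n} eff))

  effective-++⁻ʳ : ∀ m → StepwiseEffective 𝒮𝒯 S (m ++ n) → Produces 𝒮𝒯 m S V →
                   StepwiseEffective 𝒮𝒯 V n
  effective-++⁻ʳ         []      eff refl = eff
  effective-++⁻ʳ {n = n} (τ ∷ m) eff prod =
    effective-++⁻ʳ m (effective-tail {τ = τ} {m = m ++ n} eff) prod

  produces-++ : ∀ m n → Produces 𝒮𝒯 m S V → Produces 𝒮𝒯 n V W →
                Produces 𝒮𝒯 (m ++ n) S W
  produces-++ m n refl prodₙ = trans (foldl-++ _ _ m n) prodₙ

  -- Reverses of tokens, and their presence in vacuous messages.

  IsReverse-sym : IsReverse 𝒮𝒯 σ τ → IsReverse 𝒮𝒯 τ σ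
  IsReverse-sym r S V adj = ⇔-sym (r V S (swap adj))

  IsReverse-respʳ : σ ≈ ρ → IsReverse 𝒮𝒯 τ σ → IsReverse 𝒮𝒯 τ ρ
  IsReverse-respʳ σ≈ρ r S V adj = mk⇔
    (λ Sρ≡V → Equivalence.to (r S V adj) (trans (σ≈ρ S) Sρ≡V))
    (λ Vτ≡S → trans (sym (σ≈ρ S)) (Equivalence.from (r S V adj) Vτ≡S))

  IsReverse-respˡ : σ ≈ ρ → IsReverse 𝒮𝒯 σ τ → IsReverse 𝒮𝒯 ρ τ
  IsReverse-respˡ {σ} {ρ} {τ} σ≈ρ r =
    IsReverse-sym {τ} {ρ} (IsReverse-respʳ {σ} {ρ} {τ} σ≈ρ (IsReverse-sym {σ} {τ} r))

  reverse-step : IsReverse 𝒮𝒯 σ τ → proj₁ τ S ≢ S → proj₁ σ (proj₁ τ S) ≡ S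
  reverse-step {τ = τ} r moves =
    Equivalence.to (r _ _ (inj₁ (moves ∘ sym , τ , refl))) refl

  -- `τ` carries `V` to an adjacent state and `ρ` leads back from there; since `σ` also reverses
  -- `ρ`, it has to carry `V` to that same state.
  reverse-unique-on-moved : IsReverse 𝒮𝒯 σ ρ → IsReverse 𝒮𝒯 τ ρ →
                            proj₁ τ V ≢ V → proj₁ σ V ≡ proj₁ τ V
  reverse-unique-on-moved {ρ = ρ} {τ = τ} rσ rτ moves =
    Equivalence.to (rσ _ _ (inj₂ (moves ∘ sym , τ , refl)))
      (reverse-step {ρ} {τ} (IsReverse-sym {τ} {ρ} rτ) moves)

  concise-[] : Concise 𝒮𝒯 S []
  concise-[] = (λ _ _ ()) , (λ _ ()) , []

  -- Stated for an arbitrary family `f`, since the pairs left over in the induction no longer cover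
  -- all positions of a message.
  All-HasReverse-pairs :
    ∀ {ℓ} {I : Set ℓ} (f : I → Token 𝒮𝒯) (ps : List (I × I)) →
    All (λ (i , j) → MutualReverses 𝒮𝒯 (f i) (f j)) ps →
    All (λ τ → ∃[ σ ] IsReverse 𝒮𝒯 σ τ)
        (map f (concatMap (λ (i , j) → i ∷ j ∷ []) ps))
  All-HasReverse-pairs f []             []              = []
  All-HasReverse-pairs f ((i , j) ∷ ps) ((r , r⁻) ∷ rs) =
    (f j , r⁻) ∷ (f i , r) ∷ All-HasReverse-pairs f ps rs

  map-lookup-allFin : ∀ (m : Message 𝒮𝒯) → map (lookup m) (allFin _) ≡ m
  map-lookup-allFin m = trans (map-tabulate _ (lookup m)) (tabulate-lookup m)

  -- The pairing covers every position, and the token at a position is reversed by that of its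
  -- partner.
  vacuous⇒All-HasReverse : Vacuous 𝒮𝒯 m → All (λ τ → ∃[ σ ] IsReverse 𝒮𝒯 σ τ) m
  vacuous⇒All-HasReverse {m} (ps , pairing , rs) =
    subst (All _) (map-lookup-allFin m)
      (All-resp-↭ (map⁺ (lookup m) pairing) (All-HasReverse-pairs (lookup m) ps rs))

  module _ (em : ExcludedMiddle (s ⊔ t)) where

    -- Abstract, as unfolding it would prevent abstraction over the decisions below.
    abstract
      decide : ∀ (P : Set s) → Dec P
      decide P = map′ lower lift (em {Lift t P})

    -- A reverse is constrained only between distinct states, so the argument at `V` depends on
    -- whether one of the two tokens moves `V`; if neither does, both give `V`.
    reverse-unique : IsReverse 𝒮𝒯 σ ρ → IsReverse 𝒮𝒯 τ ρ → σ ≈ τ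
    reverse-unique {σ} {ρ} {τ} rσ rτ V
      with decide (proj₁ σ V ≡ V) | decide (proj₁ τ V ≡ V)
    ... | _        | no moves = reverse-unique-on-moved {σ} {ρ} {τ} rσ rτ moves
    ... | no moves | yes _    = sym (reverse-unique-on-moved {τ} {ρ} {σ} rτ rσ moves)
    ... | yes fixσ | yes fixτ = trans fixσ (sym fixτ)

    -- Counting the occurrences of a token.

    infix 4 _≟_

    _≟_ : ∀ σ τ → Dec (σ ≈ τ)
    σ ≟ τ = decide (σ ≈ τ)

    δ : Token 𝒮𝒯 → Token 𝒮𝒯 → ℕ
    δ σ τ = if does (σ ≟ τ) then 1 else 0

    count : Token 𝒮𝒯 → Message 𝒮𝒯 → ℕ
    count σ m = sum (map (δ σ) m)

    count-++ : ∀ σ m n → count σ (m ++ n) ≡ count σ m + count σ n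
    count-++ σ m n = trans (cong sum (map-++ (δ σ) m n)) (sum-++ (map (δ σ) m) _)

    count-∈ : ∀ σ m → σ ∈ m → 1 ≤ count σ m
    count-∈ σ (τ ∷ m) (here σ≈τ) with σ ≟ τ
    ... | yes _  = s≤s z≤n
    ... | no σ≉τ = contradiction σ≈τ σ≉τ
    count-∈ σ (τ ∷ m) (there σ∈m) = ≤-trans (count-∈ σ m σ∈m) (m≤n+m _ (δ σ τ))

    count-∉ : ∀ σ m → σ ∉ m → count σ m ≡ 0
    count-∉ σ []      _   = refl
    count-∉ σ (τ ∷ m) σ∉ with σ ≟ τ
    ... | yes σ≈τ = contradiction (here σ≈τ) σ∉
    ... | no _    = count-∉ σ m (σ∉ ∘ there)

    count-Unique : ∀ σ m → Unique m → count σ m ≤ 1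
    count-Unique σ []      _        = z≤n
    count-Unique σ (τ ∷ m) (τ∉ ∷ u) with σ ≟ τ
    ... | no _    = count-Unique σ m u
    ... | yes σ≈τ = s≤s (≤-reflexive (count-∉ σ m (absent m τ∉)))
      where
      absent : ∀ m → All (λ ρ → ¬ τ ≈ ρ) m → σ ∉ m
      absent (ρ ∷ m) (τ≉ρ ∷ _)  (here σ≈ρ)  =
        τ≉ρ (λ S → trans (sym (σ≈τ S)) (σ≈ρ S))
      absent (ρ ∷ m) (_ ∷ τ∉m) (there σ∈m) = absent m τ∉m σ∈m

    -- Reverses are unique and the relation is symmetric, so `σ` and `α` agree exactly when their
    -- respective reverses `τ` and `β` do.
    δ-reverse : ∀ σ τ α β → IsReverse 𝒮𝒯 σ τ → IsReverse 𝒮𝒯 α β → δ σ α ≡ δ τ β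
    δ-reverse σ τ α β στ αβ = cong (if_then 1 else 0)
      (does-⇔ (mk⇔
        (λ σ≈α → reverse-unique {τ} {σ} {β} (IsReverse-sym {σ} {τ} στ)
          (IsReverse-sym {σ} {β} (IsReverse-respˡ {α} {σ} {β} (λ S → sym (σ≈α S)) αβ)))
        (λ τ≈β → reverse-unique {σ} {τ} {α} στ
          (IsReverse-respʳ {β} {τ} {α} (λ S → sym (τ≈β S)) αβ)))
        (σ ≟ α) (τ ≟ β))

    -- Within a pair, `δ-reverse` matches the contribution of one entry to the count of `σ` with
    -- that of the other entry to the count of `τ`; it remains to swap two summands.
    count-pairs :
      ∀ σ τ {ℓ} {I : Set ℓ} (f : I → Token 𝒮𝒯) (ps : List (I × I)) →
      IsReverse 𝒮𝒯 σ τ → All (λ (i , j) → MutualReverses 𝒮𝒯 (f i) (f j)) ps →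
      let ts = map f (concatMap (λ (i , j) → i ∷ j ∷ []) ps) in count σ ts ≡ count τ ts
    count-pairs σ τ f []             στ []              = refl
    count-pairs σ τ f ((i , j) ∷ ps) στ ((r , r⁻) ∷ rs) = begin
      δ σ (f i) + (δ σ (f j) + count σ ts)
        ≡⟨ cong₂ _+_ (δ-reverse σ τ (f i) (f j) στ r)
             (cong₂ _+_ (δ-reverse σ τ (f j) (f i) στ r⁻) (count-pairs σ τ f ps στ rs)) ⟩
      δ τ (f j) + (δ τ (f i) + count τ ts)
        ≡⟨ +-assoc (δ τ (f j)) _ _ ⟨
      δ τ (f j) + δ τ (f i) + count τ ts
        ≡⟨ cong (_+ count τ ts) (+-comm (δ τ (f j)) _) ⟩
      δ τ (f i) + δ τ (f j) + count τ ts
        ≡⟨ +-assoc (δ τ (f i)) _ _ ⟩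
      δ τ (f i) + (δ τ (f j) + count τ ts) ∎
      where
      open ≡-Reasoning
      ts = map f (concatMap (λ (i , j) → i ∷ j ∷ []) ps)

    vacuous⇒balanced : Vacuous 𝒮𝒯 m → IsReverse 𝒮𝒯 σ τ → count σ m ≡ count τ m
    vacuous⇒balanced {m} {σ} {τ} (ps , pairing , rs) στ = begin
      count σ m                                        ≡⟨ permuted σ ⟩
      count σ (map (lookup m) (concatMap entries ps))  ≡⟨ count-pairs σ τ (lookup m) ps στ rs ⟩
      count τ (map (lookup m) (concatMap entries ps))  ≡⟨ permuted τ ⟨
      count τ m                                        ∎
      where
      open ≡-Reasoning
      entries : ∀ {k} → Fin k × Fin k → List (Fin k)
      entries (i , j) = i ∷ j ∷ []
      -- A count is a sum, so reordering the positions does not change it.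
      permuted : ∀ ρ → count ρ m ≡ count ρ (map (lookup m) (concatMap entries ps))
      permuted ρ = trans (cong (count ρ) (sym (map-lookup-allFin m)))
        (sum-↭ (map⁺ (δ ρ) (map⁺ (lookup m) (↭-sym pairing))))

    -- Walking a message backwards.

    module _ (reversible : M1 𝒮𝒯) where

      infix 9 _˘

      _˘ : Message 𝒮𝒯 → Message 𝒮𝒯
      []      ˘ = []
      (τ ∷ m) ˘ = m ˘ ++ [ proj₁ (reversible τ) ]

      -- `m ˘` consists of the reverses chosen by `reversible`; uniqueness identifies any other
      -- reverse of a token of `m` with the chosen one.
      ∈-˘⁺ : ∀ σ τ m → IsReverse 𝒮𝒯 σ τ → τ ∈ m → σ ∈ m ˘
      ∈-˘⁺ σ τ (ρ ∷ m) r (here τ≈ρ) = ++⁺ʳ (m ˘) (here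
        (reverse-unique {σ} {ρ} {proj₁ (reversible ρ)}
          (IsReverse-respʳ {τ} {ρ} {σ} τ≈ρ r) (proj₂ (reversible ρ))))
      ∈-˘⁺ σ τ (ρ ∷ m) r (there τ∈m) = ++⁺ˡ (∈-˘⁺ σ τ m r τ∈m)

      ∈-˘⁻ : ∀ σ τ m → IsReverse 𝒮𝒯 σ τ → τ ∈ m ˘ → σ ∈ m
      ∈-˘⁻ σ τ (ρ ∷ m) r τ∈ with ++⁻ (m ˘) τ∈
      ... | inj₁ τ∈m˘        = there (∈-˘⁻ σ τ m r τ∈m˘)
      ... | inj₂ (here τ≈ρ˘) = here (reverse-unique {σ} {τ} {ρ} r
        (IsReverse-respʳ {ρ˘} {τ} {ρ} (λ S → sym (τ≈ρ˘ S))
          (IsReverse-sym {ρ˘} {ρ} (proj₂ (reversible ρ)))))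
        where ρ˘ = proj₁ (reversible ρ)

      ˘-returns : ∀ m → StepwiseEffective 𝒮𝒯 S m → Produces 𝒮𝒯 m S V →
                  StepwiseEffective 𝒮𝒯 V (m ˘) × Produces 𝒮𝒯 (m ˘) V S
      ˘-returns     []      eff refl = (λ _ ()) , refl
      ˘-returns {S} (τ ∷ m) eff prod =
        effective-++⁺ (m ˘) (proj₁ ih) (proj₂ ih) (effective-∷⁺ {τ = τ˘} {m = []}
          -- If `τ˘` fixed `proj₁ τ S`, then `back` would identify this state with `S`, and `τ`
          -- would not move `S`.
          (λ fixed → moves (trans (sym fixed) back)) (λ _ ()))
        , produces-++ (m ˘) [ τ˘ ] (proj₂ ih) back
        where
        τ˘    = proj₁ (reversible τ)
        moves = effective-head {τ = τ} {m = m} eff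
        back : proj₁ τ˘ (proj₁ τ S) ≡ S
        back  = reverse-step {τ˘} {τ} (proj₂ (reversible τ)) moves
        ih    = ˘-returns m (effective-tail {τ = τ} {m = m} eff) prod

    -- A medium satisfies the four conditions.

    module Medium (ma : Ma 𝒮𝒯) (mb : Mb 𝒮𝒯) where

      -- [Ma] speaks of distinct states only; the empty message extends it to equal ones, so that
      -- any walk can be closed up to a return.
      connect : ∀ S V → ∃[ m ] Concise 𝒮𝒯 S m × Produces 𝒮𝒯 m S V
      connect S V with decide (S ≡ V)
      ... | yes S≡V = [] , concise-[] , S≡V
      ... | no S≢V  = ma S V S≢V

      m1 : M1 𝒮𝒯
      m1 τ with decide (∃[ S ] proj₁ τ S ≢ S)
      -- By excluded middle, a token that moves no state is the identity, which is not a token.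
      ... | no fixed = contradiction identity (𝒯-nonId (proj₂ τ))
        where
        identity : ∀ S → proj₁ τ S ≡ S
        identity S with decide (proj₁ τ S ≡ S)
        ... | yes eq   = eq
        ... | no moves = contradiction (S , moves) fixed
      ... | yes (S , moves) with connect (proj₁ τ S) S
      ...   | m , (_ , eff , _) , prod =
        All.head (vacuous⇒All-HasReverse
          (mb S (τ ∷ m) (effective-∷⁺ {τ = τ} moves eff , prod)))

      m2 : M2 𝒮𝒯
      m2 S V S≢V with ma S V S≢V
      ... | m , (con , _) , prod = m , con , prod

      vacuous⇒ineffective : StepwiseEffective 𝒮𝒯 S m → Vacuous 𝒮𝒯 m → Ineffective 𝒮𝒯 S m
      vacuous⇒ineffective {S} {m} eff vac with connect (_∙_ 𝒮𝒯 S m) S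
      -- If the closing message is empty, `m` has already returned to `S`.
      ... | []    , _                , prod = prod
      ... | τ ∷ n , (con , effₙ , _) , prod = contradiction balanced (1+n≰n ∘ unbalanced)
        where
        τ˘ = proj₁ (m1 τ)
        r  = proj₂ (m1 τ)
        vacₘₙ = mb S (m ++ τ ∷ n)
          (effective-++⁺ m eff refl effₙ , produces-++ m (τ ∷ n) refl prod)
        -- Both `m` and the whole return are vacuous, so the counts in `m` cancel.
        balanced : count τ (τ ∷ n) ≡ count τ˘ (τ ∷ n)
        balanced = +-cancelˡ-≡ (count τ m) _ _ (begin
          count τ m + count τ (τ ∷ n)
            ≡⟨ count-++ τ m (τ ∷ n) ⟨
          count τ (m ++ τ ∷ n)
            ≡⟨ vacuous⇒balanced {m ++ τ ∷ n} {τ˘} {τ} vacₘₙ r ⟨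
          count τ˘ (m ++ τ ∷ n)
            ≡⟨ count-++ τ˘ m (τ ∷ n) ⟩
          count τ˘ m + count τ˘ (τ ∷ n)
            ≡⟨ cong (_+ count τ˘ (τ ∷ n)) (vacuous⇒balanced {m} {τ˘} {τ} vac r) ⟩
          count τ m + count τ˘ (τ ∷ n) ∎)
          where open ≡-Reasoning
        -- `τ` heads the closing message, whose consistency excludes `τ˘`.
        unbalanced : count τ (τ ∷ n) ≡ count τ˘ (τ ∷ n) → 1 ≤ 0
        unbalanced eq = begin
          1                 ≤⟨ count-∈ τ (τ ∷ n) (here (λ _ → refl)) ⟩
          count τ (τ ∷ n)   ≡⟨ eq ⟩
          count τ˘ (τ ∷ n)  ≡⟨ count-∉ τ˘ (τ ∷ n) (λ τ˘∈ → con τ˘ τ τ˘∈ (here (λ _ → refl)) r) ⟩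
          0                 ∎
          where open ≤-Reasoning

      m3 : M3 𝒮𝒯
      m3 S m eff = mk⇔ (λ ineff → mb S m (eff , ineff)) (vacuous⇒ineffective {m = m} eff)

      no-opposite-tokens :
        StepwiseEffective 𝒮𝒯 S m → Consistent 𝒮𝒯 m →
        StepwiseEffective 𝒮𝒯 W n → Consistent 𝒮𝒯 n →
        Produces 𝒮𝒯 m S V → Produces 𝒮𝒯 n W V →
        σ ∈ m → τ ∈ n → ¬ IsReverse 𝒮𝒯 σ τ
      no-opposite-tokens {S} {m} {W} {n} {V} {σ} {τ}
        effₘ conₘ effₙ conₙ prodₘ prodₙ σ∈m τ∈n r
        with connect W S
      ... | p , (_ , effₚ , uniqueₚ) , prodₚ = contradiction 2≤1 1+n≰n
        where
        open ≤-Reasoning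
        n˘ = _˘ m1 n
        back = ˘-returns m1 n effₙ prodₙ
        loop = m ++ (n˘ ++ p)
        vac = mb S loop
          ( effective-++⁺ m effₘ prodₘ
              (effective-++⁺ n˘ (proj₁ back) (proj₂ back) effₚ)
          , produces-++ m (n˘ ++ p) prodₘ (produces-++ n˘ p (proj₂ back) prodₚ))
        split : ∀ ρ → count ρ loop ≡ count ρ m + (count ρ n˘ + count ρ p)
        split ρ = trans (count-++ ρ m (n˘ ++ p)) (cong (_ +_) (count-++ ρ n˘ p))
        2≤1 : 2 ≤ 1
        2≤1 = begin
          2
            -- One `σ` lies in `m`, another in `n˘`, where it reverses the `τ` of `n`.
            ≤⟨ +-mono-≤ (count-∈ σ m σ∈m)
                 (≤-trans (count-∈ σ n˘ (∈-˘⁺ m1 σ τ n r τ∈n)) (m≤m+n (count σ n˘) _)) ⟩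
          count σ m + (count σ n˘ + count σ p)
            ≡⟨ split σ ⟨
          count σ loop
            ≡⟨ vacuous⇒balanced {loop} {σ} {τ} vac r ⟩
          count τ loop
            ≡⟨ split τ ⟩
          count τ m + (count τ n˘ + count τ p)
            -- `m` contains `σ`, so its consistency excludes `τ`.
            ≡⟨ cong (_+ _) (count-∉ τ m (λ τ∈m → conₘ σ τ σ∈m τ∈m r)) ⟩
          count τ n˘ + count τ p
            -- A `τ` in `n˘` would come from a `σ` in `n`, which contains `τ` and is consistent; so
            -- only `p` can contain `τ`.
            ≡⟨ cong (_+ _) (count-∉ τ n˘ (λ τ∈n˘ → conₙ σ τ (∈-˘⁻ m1 σ τ n r τ∈n˘) τ∈n r)) ⟩
          count τ p
            ≤⟨ count-Unique τ p uniqueₚ ⟩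
          1 ∎

      m4 : M4 𝒮𝒯
      m4 S W m n effₘ conₘ effₙ conₙ eq σ τ σ∈ τ∈ r with ++⁻ m σ∈ | ++⁻ m τ∈
      ... | inj₁ σ∈m | inj₁ τ∈m = conₘ σ τ σ∈m τ∈m r
      ... | inj₂ σ∈n | inj₂ τ∈n = conₙ σ τ σ∈n τ∈n r
      ... | inj₁ σ∈m | inj₂ τ∈n =
        no-opposite-tokens {σ = σ} {τ = τ} effₘ conₘ effₙ conₙ eq refl σ∈m τ∈n r
      ... | inj₂ σ∈n | inj₁ τ∈m =
        no-opposite-tokens {σ = τ} {τ = σ} effₘ conₘ effₙ conₙ eq refl τ∈m σ∈n
          (IsReverse-sym {σ} {τ} r)

    -- The four conditions yield a medium.

    effective-reduct :
      ∀ S m → ∃[ n ] StepwiseEffective 𝒮𝒯 S n × Produces 𝒮𝒯 n S (_∙_ 𝒮𝒯 S m) ×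
                     (∀ σ → σ ∈ n → σ ∈ m)
    effective-reduct S []      = [] , (λ _ ()) , refl , λ _ ()
    effective-reduct S (τ ∷ m) with effective-reduct (proj₁ τ S) m | decide (proj₁ τ S ≡ S)
    ... | n , eff , prod , n⊆m | no moves =
      τ ∷ n , effective-∷⁺ {τ = τ} moves eff , prod ,
      λ { _ (here σ≈τ) → here σ≈τ ; σ (there σ∈n) → there (n⊆m σ σ∈n) }
    -- An ineffective token is dropped: `proj₁ τ S` is `S`, so the message found for the former
    -- serves for the latter.
    ... | n , eff , prod , n⊆m | yes fixed =
      n , subst (λ V → StepwiseEffective 𝒮𝒯 V n) fixed eff ,
      subst (λ V → Produces 𝒮𝒯 n V (_∙_ 𝒮𝒯 (proj₁ τ S) m)) fixed prod , λ σ → there ∘ n⊆m σ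

    module _ (m1 : M1 𝒮𝒯) (m4 : M4 𝒮𝒯) where

      no-repetition : ∀ S τ m σ n → StepwiseEffective 𝒮𝒯 S (τ ∷ m ++ σ ∷ n) →
                      Consistent 𝒮𝒯 (τ ∷ m ++ σ ∷ n) → ¬ τ ≈ σ
      no-repetition S τ m σ n eff con τ≈σ =
        -- Both messages produce `T`: the first from `S`, the second by undoing the step of `σ` out
        -- of `T`.
        m4 S (proj₁ σ T) (τ ∷ m) [ σ˘ ]
          (effective-++⁻ˡ {n = σ ∷ n} (τ ∷ m) eff) con₁
          (effective-∷⁺ {τ = σ˘} {m = []} (λ fixed → moves (trans (sym fixed) back)) (λ _ ()))
          con₂ (sym back)
          σ˘ τ (++⁺ʳ (τ ∷ m) (here (λ _ → refl))) (here (λ _ → refl)) r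
        where
        T     = _∙_ 𝒮𝒯 S (τ ∷ m)
        σ˘    = proj₁ (m1 σ)
        rσ    = proj₂ (m1 σ)
        r : IsReverse 𝒮𝒯 σ˘ τ
        r     = IsReverse-respʳ {σ} {τ} {σ˘} (λ S → sym (τ≈σ S)) rσ
        moves : proj₁ σ T ≢ T
        moves = effective-head {τ = σ} {m = n}
          (effective-++⁻ʳ {n = σ ∷ n} (τ ∷ m) eff refl)
        back : proj₁ σ˘ (proj₁ σ T) ≡ T
        back  = reverse-step {σ˘} {σ} rσ moves
        con₁ : Consistent 𝒮𝒯 (τ ∷ m)
        con₁ α β α∈ β∈ = con α β (++⁺ˡ α∈) (++⁺ˡ β∈)
        -- If σ˘ were its own reverse, then it would equal σ.
        con₂ : Consistent 𝒮𝒯 [ σ˘ ]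
        con₂ α β (here α≈σ˘) (here β≈σ˘) αβ = con α σ
          (++⁺ʳ (τ ∷ m) (here (reverse-unique {α} {σ˘} {σ}
            (IsReverse-respʳ {β} {σ˘} {α} β≈σ˘ αβ) (IsReverse-sym {σ˘} {σ} rσ))))
          (++⁺ʳ (τ ∷ m) (here (λ _ → refl)))
          (IsReverse-respˡ {σ˘} {α} {σ} (λ S → sym (α≈σ˘ S)) rσ)

      consistent⇒unique : ∀ S m → StepwiseEffective 𝒮𝒯 S m → Consistent 𝒮𝒯 m → Unique m
      consistent⇒unique S []      eff con = []
      consistent⇒unique S (τ ∷ m) eff con =
        All.tabulate distinct ∷
        consistent⇒unique _ m (effective-tail {τ = τ} {m = m} eff)
          (λ α β α∈ β∈ → con α β (there α∈) (there β∈))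
        where
        distinct : ∀ {σ} → σ Propositional.∈ m → ¬ τ ≈ σ
        distinct σ∈m with ∈-∃++ σ∈m
        ... | m₁ , m₂ , refl = no-repetition S τ m₁ _ m₂ eff con

      m2⇒ma : M2 𝒮𝒯 → Ma 𝒮𝒯
      m2⇒ma m2 S V S≢V with m2 S V S≢V
      ... | m , con , refl with effective-reduct S m
      ...   | n , eff , prod , n⊆m =
        n , (conₙ , eff , consistent⇒unique S n eff conₙ) , prod
        where
        conₙ : Consistent 𝒮𝒯 n
        conₙ α β α∈ β∈ = con α β (n⊆m α α∈) (n⊆m β β∈)

theorem4 : ∀ {s t : Level} → ExcludedMiddle (s ⊔ t) → (𝒮𝒯 : TokenSystem s t) →
    IsMedium 𝒮𝒯 ⇔ (M1 𝒮𝒯 × M2 𝒮𝒯 × M3 𝒮𝒯 × M4 𝒮𝒯)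
theorem4 em 𝒮𝒯 = mk⇔
  (λ (ma , mb) → let open Medium 𝒮𝒯 em ma mb in m1 , m2 , m3 , m4)
  (λ (m1 , m2 , m3 , m4) →
    m2⇒ma 𝒮𝒯 em m1 m4 m2 ,
    -- [Mb] is one direction of [M3].
    λ S m (eff , ineff) → Equivalence.to (m3 S m eff) ineff)
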